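{- Let $T$ be a search tree on a finite tree $\mathcal{T}$ and let $\mathcal{H}$ be a nonempty connected subgraph of $\mathcal{T}$. Then there is a unique search tree $T|_{\mathcal{H}}$ on $\mathcal{H}$ such that for every $v\in V(\mathcal{H})$, $$\mathtt{Path}_{T|_{\mathcal{H}}}(v)=\mathtt{Path}_T(v)\cap V(\mathcal{H}).$$
   Context: A search tree on a tree $\mathcal{T}$ is a rooted tree $T$ with vertex set $V(\mathcal{T})$ defined recursively: its root is an arbitrary vertex $r$, and the children of $r$ are the roots of search trees built on the connected components of $\mathcal{T}-r$; a single-vertex tree has only itself as search tree. For a rooted tree $T$ and vertex $v$, $\mathtt{Path}_T(v)$ is the set of vertices on the path in $T$ from the root to $v$, including both endpoints. -}

module Defs where

open import Level using (0ℓ)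
open import Data.Nat.Base using (ℕ; _≤_)
open import Data.Fin.Base using (Fin)
open import Data.Fin.Subset using (Subset; Nonempty; _∈_; _⊆_; _-_)
open import Data.List.Base using (List; []; _∷_; length)
import Data.List.Membership.Propositional as List
open import Data.List.Relation.Binary.Pointwise.Base using (Pointwise)
open import Data.List.Relation.Unary.Unique.Propositional using (Unique)
open import Data.Product.Base using (_×_; ∃-syntax)
open import Function.Bundles using (_⇔_)
open import Relation.Binary.Construct.Closure.ReflexiveTransitive using (Star; ε; _◅_)
open import Relation.Binary.Core using (Rel; _⇒_)
open import Relation.Binary.Definitions using (Decidable; Symmetric; Irreflexive)
open import Relation.Binary.PropositionalEquality.Core using (_≡_)
open import Relation.Nullary.Negation.Core using (¬_)
open import Relation.Unary using (Pred)

private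
  variable
    n : ℕ

-- A finite simple graph. Its vertices form a subset of Fin n, rather than all
-- of it, so that a graph and its subgraphs have vertices in the same type.
record Graph (n : ℕ) : Set₁ where
  field
    V       : Subset n
    E       : Rel (Fin n) 0ℓ
    E?      : Decidable E
    E-sym   : Symmetric E
    E-irr   : Irreflexive _≡_ E
    E-ends  : ∀ {u v} → E u v → u ∈ V × v ∈ V

open Graph public

record Subgraph (H G : Graph n) : Set where
  field
    V-⊆ : V H ⊆ V G
    E-⊆ : E H ⇒ E G

-- Adjacency in the subgraph G[S] induced by S.
InducedE : Graph n → Subset n → Rel (Fin n) 0ℓ
InducedE G S u v = E G u v × u ∈ S × v ∈ S

-- G[S] is connected; the empty graph counts as connected here, so
-- nonemptiness is always required separately.
ConnectedOn : Graph n → Subset n → Set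
ConnectedOn G S = ∀ {u v} → u ∈ S → v ∈ S → Star (InducedE G S) u v

Connected : Graph n → Set
Connected G = ConnectedOn G (V G)

vertices : {R : Rel (Fin n) 0ℓ} {u v : Fin n} → Star R u v → List (Fin n)
vertices {u = u} ε       = u ∷ []
vertices {u = u} (_ ◅ p) = u ∷ vertices p

-- A cycle is a path on at least three distinct vertices together with an edge
-- from its last vertex back to its first.
Acyclic : Graph n → Set
Acyclic G = ∀ {u v} (p : Star (E G) u v) →
  Unique (vertices p) → 3 ≤ length (vertices p) → ¬ E G v u

record IsTree (G : Graph n) : Set where
  field
    nonempty  : Nonempty (V G)
    connected : Connected G
    acyclic   : Acyclic G

-- C is the vertex set of a connected component of G[S], i.e. of a maximal
-- nonempty connected subgraph. Components are induced subgraphs, so they are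
-- represented by their vertex sets.
record IsComponent (G : Graph n) (S C : Subset n) : Set where
  field
    ⊆-S       : C ⊆ S
    nonempty  : Nonempty C
    connected : ConnectedOn G C
    maximal   : ∀ {D} → C ⊆ D → D ⊆ S → ConnectedOn G D → D ⊆ C

-- Rooted trees with vertices in Fin n. The order in which the children are
-- listed carries no meaning: trees are compared by _≈_ below. Distinctness of
-- the labels is not built in, but holds for all search trees.
data RootedTree (n : ℕ) : Set where
  node : (r : Fin n) (children : List (RootedTree n)) → RootedTree n

root : RootedTree n → Fin n
root (node r _) = r

-- TreeEdge T u v: v is a child of u in T.
data TreeEdge {n : ℕ} : RootedTree n → Rel (Fin n) 0ℓ where
  top   : ∀ {r ts t} → t List.∈ ts → TreeEdge (node r ts) r (root t)
  below : ∀ {r ts t u v} → t List.∈ ts → TreeEdge t u v → TreeEdge (node r ts) u v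

-- Equality of rooted trees as graphs with a distinguished root. (The vertex
-- set consists of the root and the endpoints of the edges.)
infix 4 _≈_
_≈_ : Rel (RootedTree n) 0ℓ
T ≈ T′ = root T ≡ root T′ × (∀ u v → TreeEdge T u v ⇔ TreeEdge T′ u v)

-- RootPath T v p: p lists the vertices on the path in T from the root to v.
data RootPath {n : ℕ} : RootedTree n → Fin n → List (Fin n) → Set where
  here  : ∀ {r ts} → RootPath (node r ts) r (r ∷ [])
  there : ∀ {r ts t v p} → t List.∈ ts → RootPath t v p → RootPath (node r ts) v (r ∷ p)

Path : RootedTree n → Fin n → Pred (Fin n) 0ℓ
Path T v u = ∃[ p ] RootPath T v p × u List.∈ p

-- IsSearchTreeOn G S T: T is a search tree on G[S]. Cs enumerates, without
-- repetition, the components of G[S] - r = G[S - r], and the children of r are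
-- search trees on these components, exactly one for each. If S = {r} there are
-- no components, and T is the single vertex r.
data IsSearchTreeOn {n : ℕ} (G : Graph n) : Subset n → RootedTree n → Set where
  node : ∀ {S r ts} (Cs : List (Subset n)) →
         r ∈ S →
         Unique Cs →
         (∀ C → C List.∈ Cs ⇔ IsComponent G (S - r) C) →
         Pointwise (IsSearchTreeOn G) Cs ts →
         IsSearchTreeOn G S (node r ts)

IsSearchTree : Graph n → RootedTree n → Set
IsSearchTree G T = IsSearchTreeOn G (V G) T

{-# OPTIONS --safe #-}

-- A subgraph ℋ that is connected in a tree is induced, so both graphs have the
-- same connected vertex sets inside V ℋ. For existence, let T be a search tree
-- with root r on S and let U ⊆ S be nonempty and connected. If r ∉ U, then U
-- lies in one component of S - r, and one restricts the corresponding child.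
-- If r ∈ U, then the components of U - r are the nonempty intersections of U
-- with the components of S - r, because connected sets in a tree have connected
-- intersections; the restrictions to these become the children of r.
-- For uniqueness, the root is the only vertex r whose path is {r}, and the paths
-- of a child are obtained by intersecting with the component.
module Submission where

open import Defs
open import Data.Nat.Base using (ℕ)
open import Data.Fin.Subset using (Nonempty; _∈_)
open import Data.Product using (_×_; ∃!)
open import Relation.Unary using (_≐_; _∩_)

open import Level using (Level; 0ℓ)
open import Data.Bool.Properties as Bool using ()
open import Data.Fin.Base using (Fin; zero; suc)
open import Data.Fin.Properties using (_≟_)
open import Data.Fin.Subset as Subset using (Subset; inside; outside; _∉_; _⊆_; _-_)
open import Data.Fin.Subset.Properties
  using (_∈?_; nonempty?; ⊆-antisym; drop-there; p─q⊆p; p∩q⊆p;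
         x∈p∩q⁺; x∈p∩q⁻; p⊆p∪q; q⊆p∪q; x∈p∪q⁻; x∈p∧x≢y⇒x∈p-y)
open import Data.List.Base using (List; []; _∷_; length; map; filter; deduplicate; zip)
import Data.List.Membership.DecPropositional as DecMembership
import Data.List.Membership.Propositional as List
open import Data.List.Membership.Propositional.Properties
  using (∈-map∘filter⁺; ∈-map∘filter⁻; ∈-deduplicate⁺; ∈-deduplicate⁻)
open import Data.List.Relation.Binary.Pointwise.Base as Pointwise
  using (Pointwise; []; _∷_)
open import Data.List.Relation.Unary.All as All using (All; []; _∷_)
open import Data.List.Relation.Unary.All.Properties using (¬Any⇒All¬)
open import Data.List.Relation.Unary.AllPairs using ([]; _∷_)
open import Data.List.Relation.Unary.Any as Any using (here; there)
open import Data.List.Relation.Unary.Unique.Propositional using (Unique)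
import Data.List.Relation.Unary.Unique.DecPropositional.Properties as DecUnique
open import Data.Nat.Base using (_≤_; s≤s; z≤n)
open import Data.Product using (∃; ∃-syntax; _,_; proj₁; proj₂)
open import Data.Sum.Base using (inj₁; inj₂)
open import Data.Vec.Base using ([]; _∷_; here; there)
open import Data.Vec.Properties using (≡-dec)
open import Function.Base using (_∘_; id)
open import Function.Bundles using (_⇔_; mk⇔; Equivalence)
open import Relation.Binary.Construct.Closure.ReflexiveTransitive as Star
  using (Star; ε; _◅_; _◅◅_)
open import Relation.Binary.Core using (Rel; REL; _⇒_)
open import Relation.Binary.PropositionalEquality.Core
  using (_≡_; _≢_; refl; sym; subst; cong)
open import Relation.Nullary.Decidable.Core
  using (Dec; yes; no; decidable-stable; ¬¬-excluded-middle)
open import Relation.Nullary.Negation.Core using (¬_; contradiction)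
open import Relation.Unary.Properties using (≐-sym; ≐-trans)

open Equivalence using (to; from)

private
  variable
    a b ℓ : Level
    A B : Set a
    n : ℕ
    G H : Graph n
    S U C D : Subset n
    r u v w : Fin n
    T t : RootedTree n
    ts : List (RootedTree n)
    Cs : List (Subset n)
    R : Rel (Fin n) 0ℓ

-- Lists and finite sets

-- Membership in the zip records which child belongs to which component, so that `zip-functional`
-- can turn a common component into equality of children.
pointwise-lookupˡ : ∀ {R : REL A B ℓ} {xs ys x} → Pointwise R xs ys → x List.∈ xs →
  ∃[ y ] (x , y) List.∈ zip xs ys × y List.∈ ys × R x y
pointwise-lookupˡ (Rxy ∷ _) (here refl) = _ , here refl , here refl , Rxy
pointwise-lookupˡ (_ ∷ Rxys) (there x∈xs) =
  let y , xy∈ , y∈ys , Rxy = pointwise-lookupˡ Rxys x∈xs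
  in  y , there xy∈ , there y∈ys , Rxy

pointwise-lookupʳ : ∀ {R : REL A B ℓ} {xs ys y} → Pointwise R xs ys → y List.∈ ys →
  ∃[ x ] (x , y) List.∈ zip xs ys × x List.∈ xs × R x y
pointwise-lookupʳ (Rxy ∷ _) (here refl) = _ , here refl , here refl , Rxy
pointwise-lookupʳ (_ ∷ Rxys) (there y∈ys) =
  let x , xy∈ , x∈xs , Rxy = pointwise-lookupʳ Rxys y∈ys
  in  x , there xy∈ , there x∈xs , Rxy

zip-∈ˡ : ∀ {xs : List A} {ys : List B} {x y} → (x , y) List.∈ zip xs ys → x List.∈ xs
zip-∈ˡ {xs = _ ∷ _} {_ ∷ _} (here refl) = here refl
zip-∈ˡ {xs = _ ∷ _} {_ ∷ _} (there xy∈) = there (zip-∈ˡ xy∈)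

zip-functional : ∀ {xs : List A} {ys : List B} {x y z} → Unique xs →
  (x , y) List.∈ zip xs ys → (x , z) List.∈ zip xs ys → y ≡ z
zip-functional {xs = _ ∷ _} {_ ∷ _} _ (here refl) (here refl) = refl
zip-functional {xs = _ ∷ _} {_ ∷ _} (x∉ ∷ _) (here refl) (there xz∈) =
  contradiction refl (All.lookup x∉ (zip-∈ˡ xz∈))
zip-functional {xs = _ ∷ _} {_ ∷ _} (x∉ ∷ _) (there xy∈) (here refl) =
  contradiction refl (All.lookup x∉ (zip-∈ˡ xy∈))
zip-functional {xs = _ ∷ _} {_ ∷ _} (_ ∷ uniq) (there xy∈) (there xz∈) =
  zip-functional uniq xy∈ xz∈

pointwise-choice : ∀ {R : REL A B ℓ} {xs} → All (λ x → ∃ (R x)) xs → ∃ (Pointwise R xs)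
pointwise-choice [] = [] , []
pointwise-choice ((y , Rxy) ∷ Rxs) =
  let ys , Rxys = pointwise-choice Rxs in y ∷ ys , Rxy ∷ Rxys

x∉p-x : (p : Subset n) (x : Fin n) → x ∉ p - x
x∉p-x (outside ∷ p) zero ()
x∉p-x (inside ∷ p) zero ()
x∉p-x (_ ∷ p) (suc x) x∈ = x∉p-x p x (drop-there x∈)

⊆-remove : U ⊆ S → U - r ⊆ S - r
⊆-remove {U = U} {r = r} U⊆S x∈ =
  x∈p∧x≢y⇒x∈p-y (U⊆S (p─q⊆p U _ x∈)) λ { refl → x∉p-x U r x∈ }

-- `P` may be undecidable, but under double negation it can be decided at finitely many points, one
-- in each step of the induction on `n`.
¬¬-comprehension : (P : Fin n → Set ℓ) → ¬ ¬ (∃[ S ] ∀ x → x ∈ S ⇔ P x)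
¬¬-comprehension {n = ℕ.zero} P ¬S = ¬S ([] , λ ())
¬¬-comprehension {n = ℕ.suc _} P ¬S =
  ¬¬-comprehension (P ∘ suc) λ (S , S⇔P) → ¬¬-excluded-middle λ where
    (yes p) → ¬S (inside ∷ S , λ where
      zero    → mk⇔ (λ _ → p) (λ _ → here)
      (suc x) → mk⇔ (to (S⇔P x) ∘ drop-there) (there ∘ from (S⇔P x)))
    (no ¬p) → ¬S (outside ∷ S , λ where
      zero    → mk⇔ (λ ()) (λ p → contradiction p ¬p)
      (suc x) → mk⇔ (to (S⇔P x) ∘ drop-there) (there ∘ from (S⇔P x)))

-- Walks

IsSimple : Star R u v → Set
IsSimple p = Unique (vertices p)

simple-suffix : (p : Star R u v) → IsSimple p → w List.∈ vertices p →
  ∃[ q ] IsSimple {R = R} {w} {v} q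
simple-suffix ε       simple       (here refl) = ε , simple
simple-suffix (e ◅ p) simple       (here refl) = e ◅ p , simple
simple-suffix (_ ◅ p) (_ ∷ simple) (there w∈p) = simple-suffix p simple w∈p

simplify : Star R u v → ∃[ q ] IsSimple {R = R} {u} {v} q
simplify ε = ε , [] ∷ []
simplify {u = u} (e ◅ p) with simplify p
... | q , simple with DecMembership._∈?_ _≟_ u (vertices q)
-- The start `u` recurs on the simplified tail; cutting out the loop leaves the suffix from that
-- occurrence.
...   | yes u∈q = simple-suffix q simple u∈q
...   | no  u∉q = e ◅ q , ¬Any⇒All¬ _ u∉q ∷ simple

vertices-map : ∀ {Q : Rel (Fin n) 0ℓ} (f : R ⇒ Q) (p : Star R u v) →
  vertices (Star.map f p) ≡ vertices p
vertices-map f ε       = refl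
vertices-map f (_ ◅ p) = cong (_ ∷_) (vertices-map f p)

within : ∀ {P : Fin n → Set} (p : Star R u v) → All P (vertices p) →
  Star (λ x y → R x y × P x × P y) u v
within ε _ = ε
within (e ◅ ε) (Pu ∷ Pv ∷ []) = (e , Pu , Pv) ◅ ε
within (e ◅ p@(_ ◅ _)) (Pu ∷ Pp@(Pw ∷ _)) = (e , Pu , Pw) ◅ within p Pp

reverse-induced : (G : Graph n) →
  Star (InducedE G S) u v → Star (InducedE G S) v u
reverse-induced G = Star.reverse λ (e , u∈S , v∈S) → E-sym G e , v∈S , u∈S

induced-mono : S ⊆ U → InducedE G S ⇒ InducedE G U
induced-mono S⊆U (e , u∈S , v∈S) = e , S⊆U u∈S , S⊆U v∈S

induced-end : u ∈ S → Star (InducedE G S) u v → v ∈ S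
induced-end u∈S ε = u∈S
induced-end {G = G} _ ((_ , _ , w∈S) ◅ p) = induced-end {G = G} w∈S p

-- Acyclic graphs

-- Once the walk is made simple, zero steps contradict irreflexivity, one step is the excluded edge,
-- and two or more steps close to a cycle with the edge from `v` to `u`.
edge-is-bridge : Acyclic G → E G u v → ¬ Star (λ x y → E G x y × ¬ (x ≡ u × y ≡ v)) u v
edge-is-bridge {G = G} acyclic uv p with simplify p
... | ε , _ = E-irr G refl uv
... | (_ , ≢uv) ◅ ε , _ = ≢uv (refl , refl)
... | q@(_ ◅ _ ◅ q′) , simple = acyclic
  (Star.map proj₁ q) (subst Unique (sym (vertices-map proj₁ q)) simple)
  -- The first two steps contribute two vertices, and `q′` at least its endpoint.
  (subst (λ ws → 3 ≤ length ws) (sym (vertices-map proj₁ q)) (s≤s (s≤s (1≤length q′))))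
  (E-sym G uv)
  where
  1≤length : (q : Star R u v) → 1 ≤ length (vertices q)
  1≤length ε       = s≤s z≤n
  1≤length (_ ◅ _) = s≤s z≤n

-- If the first edge u w of the path left S, then going from u to v inside S and
-- back to w along the rest of the path would bypass this edge.
simple-path-⊆-connected : Acyclic G → ConnectedOn G S → R ⇒ E G →
  (p : Star R u v) → IsSimple p → u ∈ S → v ∈ S → All (_∈ S) (vertices p)
simple-path-⊆-connected _ _ _ ε _ u∈S _ = u∈S ∷ []
simple-path-⊆-connected {G = G} {S = S} {R = R} {u = u} acyclic connected R⇒E
  (_◅_ {j = w} uw p) (u∉p ∷ simple) u∈S v∈S =
  u∈S ∷ simple-path-⊆-connected {G = G} acyclic connected R⇒E p simple w∈S v∈S
  where
  Bypass : Rel (Fin _) 0ℓ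
  Bypass x y = E G x y × ¬ (x ≡ u × y ≡ w)

  inside-S : w ∉ S → InducedE G S ⇒ Bypass
  inside-S w∉S (e , _ , y∈S) = e , λ { (_ , refl) → w∉S y∈S }

  -- Simplicity keeps `u` off `p`, so no reversed edge of `p` starts at `u`.
  back-along-p : ∀ {x y} → R x y × u ≢ x × u ≢ y → Bypass y x
  back-along-p (e , _ , u≢y) = E-sym G (R⇒E e) , λ { (refl , _) → u≢y refl }

  w∈S : w ∈ S
  w∈S = decidable-stable (w ∈? S) λ w∉S → edge-is-bridge {G = G} acyclic (R⇒E uw)
    (Star.map (inside-S w∉S) (connected u∈S v∈S) ◅◅
     Star.reverse back-along-p (within p u∉p))

-- A simple path inside `C` between two vertices of `U` cannot leave `U`, by
-- `simple-path-⊆-connected`.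
∩-connected : Acyclic G → ConnectedOn G C → ConnectedOn G U → ConnectedOn G (C Subset.∩ U)
∩-connected {G = G} {C = C} {U = U} acyclic connC connU u∈ v∈ =
  let u∈C , u∈U = x∈p∩q⁻ C U u∈
      v∈C , v∈U = x∈p∩q⁻ C U v∈
      p , simple = simplify (connC u∈C v∈C)
      p⊆U = simple-path-⊆-connected {G = G} acyclic connU proj₁ p simple u∈U v∈U
  in  Star.map (λ ((e , x∈C , y∈C) , x∈U , y∈U) → e , x∈p∩q⁺ (x∈C , x∈U) , x∈p∩q⁺ (y∈C , y∈U))
        (within p p⊆U)

-- For a subgraph `H` of `G` and `S = V H`, this says that `H` is induced.
AgreeOn : Graph n → Graph n → Subset n → Set
AgreeOn G H S = ∀ {u v} → u ∈ S → v ∈ S → E G u v ⇔ E H u v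

-- An edge of `G` missing from `H` would be bypassed by a walk in the connected graph `H`,
-- contradicting `edge-is-bridge`.
connected-subgraph-induced : Acyclic G → Subgraph H G → Connected H → AgreeOn G H (V H)
connected-subgraph-induced {G = G} {H = H} acyclic H⊆G connected {u} {v} u∈H v∈H = mk⇔
  (λ uv → decidable-stable (E? H u v) λ ¬uv → edge-is-bridge {G = G} acyclic uv
    (Star.map (λ (e , _) → Subgraph.E-⊆ H⊆G e , λ { (refl , refl) → ¬uv e })
      (connected u∈H v∈H)))
  (Subgraph.E-⊆ H⊆G)

-- Components

agree-connected : AgreeOn G H S → C ⊆ S → ConnectedOn G C → ConnectedOn H C
agree-connected agree C⊆S connected u∈C v∈C =
  Star.map (λ (e , x∈C , y∈C) → to (agree (C⊆S x∈C) (C⊆S y∈C)) e , x∈C , y∈C)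
    (connected u∈C v∈C)

agree-sym : AgreeOn G H S → AgreeOn H G S
agree-sym agree u∈S v∈S = mk⇔ (from (agree u∈S v∈S)) (to (agree u∈S v∈S))

agree-mono : U ⊆ S → AgreeOn G H S → AgreeOn G H U
agree-mono U⊆S agree u∈U v∈U = agree (U⊆S u∈U) (U⊆S v∈U)

agree-component : AgreeOn G H S → IsComponent G S C → IsComponent H S C
agree-component {G = G} {H = H} agree comp = record
  { ⊆-S       = ⊆-S
  ; nonempty  = nonempty
  ; connected = agree-connected {G = G} {H = H} agree ⊆-S connected
  ; maximal   = λ C⊆D D⊆S connD →
      maximal C⊆D D⊆S (agree-connected {G = H} {H = G} (agree-sym {G = G} {H = H} agree) D⊆S connD)
  }
  where open IsComponent comp

∪-connected : ConnectedOn G C → ConnectedOn G D → w ∈ C → w ∈ D →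
  ConnectedOn G (C Subset.∪ D)
∪-connected {G = G} {C = C} {D = D} {w = w} connC connD w∈C w∈D u∈ v∈ =
  reverse-induced G (from-w u∈) ◅◅ from-w v∈
  where
  from-w : ∀ {x} → x ∈ C Subset.∪ D → Star (InducedE G (C Subset.∪ D)) w x
  from-w x∈ with x∈p∪q⁻ C D x∈
  ... | inj₁ x∈C = Star.map (induced-mono {G = G} (p⊆p∪q D)) (connC w∈C x∈C)
  ... | inj₂ x∈D = Star.map (induced-mono {G = G} (q⊆p∪q C D)) (connD w∈D x∈D)

-- Because of the shared vertex `w`, the union of `C` and `D` is connected, so maximality of `C`
-- applies to it.
component-absorbs : IsComponent G S C → ConnectedOn G D → D ⊆ S → w ∈ C → w ∈ D → D ⊆ C
component-absorbs {G = G} {S = S} {C = C} {D = D} comp connD D⊆S w∈C w∈D x∈D =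
  maximal (p⊆p∪q D) ∪⊆S (∪-connected {G = G} connected connD w∈C w∈D) (q⊆p∪q C D x∈D)
  where
  open IsComponent comp
  ∪⊆S : C Subset.∪ D ⊆ S
  ∪⊆S y∈ with x∈p∪q⁻ C D y∈
  ... | inj₁ y∈C = ⊆-S y∈C
  ... | inj₂ y∈D = D⊆S y∈D

components-disjoint : IsComponent G S C → IsComponent G S D → w ∈ C → w ∈ D → C ≡ D
components-disjoint compC compD w∈C w∈D = ⊆-antisym
  (component-absorbs compD (connected compC) (⊆-S compC) w∈D w∈C)
  (component-absorbs compC (connected compD) (⊆-S compD) w∈C w∈D)
  where open IsComponent

reachable-component : u ∈ S → (∀ x → x ∈ C ⇔ Star (InducedE G S) u x) → IsComponent G S C
reachable-component {u = u} {S = S} {C = C} {G = G} u∈S C⇔ = record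
  { ⊆-S       = λ x∈C → induced-end {G = G} u∈S (to (C⇔ _) x∈C)
  ; nonempty  = u , u∈C
  ; connected = λ x∈C y∈C →
      reverse-induced G (stays-in-C u∈C (to (C⇔ _) x∈C)) ◅◅
      stays-in-C u∈C (to (C⇔ _) y∈C)
  ; maximal   = λ C⊆D D⊆S connD x∈D →
      from (C⇔ _) (Star.map (induced-mono {G = G} D⊆S) (connD (C⊆D u∈C) x∈D))
  }
  where
  u∈C : u ∈ C
  u∈C = from (C⇔ u) ε

  -- Each next vertex on the walk is again reachable from `u`, hence in `C`.
  stays-in-C : ∀ {x y} → x ∈ C → Star (InducedE G S) x y → Star (InducedE G C) x y
  stays-in-C x∈C ε = ε
  stays-in-C x∈C (e ◅ p) =
    let z∈C = from (C⇔ _) (to (C⇔ _) x∈C ◅◅ (e ◅ ε))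
    in  (proj₁ e , x∈C , z∈C) ◅ stays-in-C z∈C p

EnumeratesComponents : Graph n → Subset n → List (Subset n) → Set
EnumeratesComponents G S Cs = ∀ C → C List.∈ Cs ⇔ IsComponent G S C

-- Membership of u in a listed component is decidable, so the component of u is
-- only needed up to double negation.
component-of : EnumeratesComponents G S Cs → u ∈ S →
  ∃[ C ] C List.∈ Cs × IsComponent G S C × u ∈ C
component-of {G = G} {S = S} {Cs = Cs} {u = u} enum u∈S =
  let C , C∈Cs , u∈C = List.find (decidable-stable (Any.any? (u ∈?_) Cs) λ ¬any →
        ¬¬-comprehension (Star (InducedE G S) u) λ (C , C⇔) →
          ¬any (List.lose (from (enum C) (reachable-component u∈S C⇔)) (from (C⇔ u) ε)))
  in  C , C∈Cs , to (enum C) C∈Cs , u∈C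

r∉component : IsComponent G (S - r) C → r ∉ C
r∉component {S = S} {r = r} comp r∈C = x∉p-x S r (IsComponent.⊆-S comp r∈C)

-- For maximality, a connected `D` inside `U - r` that contains the intersection meets `C` in `w`,
-- so `C` absorbs it.
component-of-∩ : Acyclic G → U ⊆ S → ConnectedOn G U → IsComponent G (S - r) C →
  Nonempty (C Subset.∩ U) → IsComponent G (U - r) (C Subset.∩ U)
component-of-∩ {G = G} {U = U} {r = r} {C = C} acyclic U⊆S connU comp (w , w∈C∩U) = record
  { ⊆-S       = λ x∈ → let x∈C , x∈U = x∈p∩q⁻ C U x∈ in
      x∈p∧x≢y⇒x∈p-y x∈U λ { refl → r∉component comp x∈C }
  ; nonempty  = w , w∈C∩U
  ; connected = ∩-connected {G = G} acyclic (IsComponent.connected comp) connU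
  ; maximal   = λ C∩U⊆D D⊆U-r connD x∈D → x∈p∩q⁺
      ( component-absorbs comp connD (⊆-remove U⊆S ∘ D⊆U-r)
          (p∩q⊆p C U w∈C∩U) (C∩U⊆D w∈C∩U) x∈D
      , p─q⊆p U _ (D⊆U-r x∈D))
  }

-- Filtering removes empty intersections; `deduplicate` yields `Unique` by construction, without
-- appeal to the disjointness of components.
restrictComponents : Subset n → List (Subset n) → List (Subset n)
restrictComponents U Cs = deduplicate (≡-dec Bool._≟_)
  (map (Subset._∩ U) (filter (λ C → nonempty? (C Subset.∩ U)) Cs))

restrictComponents-unique : (U : Subset n) (Cs : List (Subset n)) →
  Unique (restrictComponents U Cs)
restrictComponents-unique U Cs = DecUnique.deduplicate-! (≡-dec Bool._≟_) _

restrictComponents-enumerates : Acyclic G → U ⊆ S → ConnectedOn G U →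
  EnumeratesComponents G (S - r) Cs →
  EnumeratesComponents G (U - r) (restrictComponents U Cs)
restrictComponents-enumerates {G = G} {U = U} {S = S} {r = r} {Cs = Cs}
  acyclic U⊆S connU enum D = mk⇔ sound complete
  where
  meets? : (C : Subset _) → Dec (Nonempty (C Subset.∩ U))
  meets? C = nonempty? (C Subset.∩ U)

  sound : D List.∈ restrictComponents U Cs → IsComponent G (U - r) D
  sound D∈ with ∈-map∘filter⁻ (Subset._∩ U) meets? (∈-deduplicate⁻ (≡-dec Bool._≟_) _ D∈)
  ... | C , C∈Cs , refl , meets = component-of-∩ acyclic U⊆S connU (to (enum C) C∈Cs) meets

  complete : IsComponent G (U - r) D → D List.∈ restrictComponents U Cs
  complete comp =
    let open IsComponent comp
        x , x∈D = nonempty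
        C , C∈Cs , compC , x∈C = component-of enum (⊆-remove U⊆S (⊆-S x∈D))
        D⊆C = component-absorbs compC connected (⊆-remove U⊆S ∘ ⊆-S) x∈C x∈D
        D⊆C∩U : D ⊆ C Subset.∩ U
        D⊆C∩U y∈D = x∈p∩q⁺ (D⊆C y∈D , p─q⊆p U _ (⊆-S y∈D))
        comp∩ = component-of-∩ acyclic U⊆S connU compC (x , D⊆C∩U x∈D)
        -- The intersection is itself connected inside `U - r`, so maximality of `D` gives the
        -- reverse inclusion.
        C∩U⊆D = maximal D⊆C∩U (IsComponent.⊆-S comp∩) (IsComponent.connected comp∩)
    in  ∈-deduplicate⁺ (≡-dec Bool._≟_) (∈-map∘filter⁺ (Subset._∩ U) meets?
          (C , C∈Cs , ⊆-antisym D⊆C∩U C∩U⊆D , x , D⊆C∩U x∈D))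

-- Search trees

module _ (P : Subset n → RootedTree n → Set)
  (step : ∀ {S r Cs ts} → r ∈ S → Unique Cs → EnumeratesComponents G (S - r) Cs →
          Pointwise (λ C t → IsSearchTreeOn G C t × P C t) Cs ts → P S (node r ts))
  where

  -- Children occur nested in `Pointwise`, hence the mutual companion for lists. The step receives
  -- each child's search tree property together with `P`.
  searchTree-induction : IsSearchTreeOn G S T → P S T
  searchTrees-induction : Pointwise (IsSearchTreeOn G) Cs ts →
    Pointwise (λ C t → IsSearchTreeOn G C t × P C t) Cs ts

  searchTree-induction (node Cs r∈S uniq enum children) =
    step r∈S uniq enum (searchTrees-induction children)

  searchTrees-induction [] = []
  searchTrees-induction (st ∷ sts) = (st , searchTree-induction st) ∷ searchTrees-induction sts

path-root : Path T v w → Path T v (root T)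
path-root (_ , here , _)      = _ , here , here refl
path-root (_ , there t∈ p , _) = _ , there t∈ p , here refl

path-end : ∀ {p} → RootPath T v p → Path T v v
path-end path = _ , path , end path
  where
  end : ∀ {T : RootedTree n} {v p} → RootPath T v p → v List.∈ p
  end here        = here refl
  end (there _ p) = there (end p)

path-child : t List.∈ ts → Path t v w → Path (node r ts) v w
path-child t∈ (_ , p , w∈p) = _ , there t∈ p , there w∈p

path-⊆ : IsSearchTreeOn G S T → Path T v w → w ∈ S
path-⊆ {G = G} st = searchTree-induction {G = G} PathsWithin step st
  where
  PathsWithin : Subset n → RootedTree n → Set
  PathsWithin S T = ∀ {v w} → Path T v w → w ∈ S

  step : r ∈ S → Unique Cs → EnumeratesComponents G (S - r) Cs →
    Pointwise (λ C t → IsSearchTreeOn G C t × PathsWithin C t) Cs ts →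
    PathsWithin S (node r ts)
  step r∈S _ _ _ (_ , here , here refl) = r∈S
  step r∈S _ _ _ (_ , there _ _ , here refl) = r∈S
  step {S = S} _ _ enum children (_ , there t∈ts p , there w∈p) =
    let C , _ , C∈Cs , _ , ih = pointwise-lookupʳ children t∈ts
    in  p─q⊆p S _ (IsComponent.⊆-S (to (enum C) C∈Cs) (ih (_ , p , w∈p)))

-- Labels are not distinct by construction, so a second occurrence of `r` must be excluded: it would
-- lie in a component of `S - r`.
path-of-root : EnumeratesComponents G (S - r) Cs → Pointwise (IsSearchTreeOn G) Cs ts →
  Path (node r ts) r w → w ≡ r
path-of-root _ _ (_ , here , here refl) = refl
path-of-root enum children (_ , there t∈ts p , _) =
  let C , _ , C∈Cs , st = pointwise-lookupʳ children t∈ts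
  in  contradiction (path-⊆ st (path-end p)) (r∉component (to (enum C) C∈Cs))

-- Any path to `v` enters a child whose component contains `v`. Disjointness makes that component
-- `C`, and uniqueness of the list makes the child `t`.
path-in-child : Unique Cs → EnumeratesComponents G (S - r) Cs →
  Pointwise (IsSearchTreeOn G) Cs ts → (C , t) List.∈ zip Cs ts → v ∈ C → w ∈ C →
  Path (node r ts) v w → Path t v w
path-in-child {C = C} uniq enum children Ct∈ v∈C w∈C path
  with to (enum C) (zip-∈ˡ Ct∈) | path
... | comp | _ , here , _ = contradiction v∈C (r∉component comp)
... | comp | _ , there _ _ , here refl = contradiction w∈C (r∉component comp)
... | comp | _ , there t′∈ts p , there w∈p
  with pointwise-lookupʳ children t′∈ts
... | C′ , C′t′∈ , C′∈Cs , st
  with refl ← components-disjoint comp (to (enum C′) C′∈Cs) v∈C (path-⊆ st (path-end p))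
  with refl ← zip-functional uniq Ct∈ C′t′∈ = _ , p , w∈p

-- Restriction

IsRestrictionOn : Graph n → RootedTree n → Subset n → RootedTree n → Set
IsRestrictionOn G T U T′ =
  IsSearchTreeOn G U T′ × (∀ v → v ∈ U → Path T′ v ≐ Path T v ∩ (_∈ U))

-- Quantifying over all `U` lets the induction hypothesis be used for a different subset in each
-- child.
Restrictable : Graph n → Subset n → RootedTree n → Set
Restrictable G S T =
  ∀ U → U ⊆ S → Nonempty U → ConnectedOn G U → ∃ (IsRestrictionOn G T U)

-- Serves both cases of the existence proof: `U` itself when it misses `r`, and each component of
-- `U - r` otherwise. Inside the component containing `U`, the paths of the whole tree and of the
-- child agree.
restrict-below-root : Unique Cs → EnumeratesComponents G (S - r) Cs →
  Pointwise (λ C t → IsSearchTreeOn G C t × Restrictable G C t) Cs ts →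
  Restrictable G (S - r) (node r ts)
restrict-below-root uniq enum children U U⊆S-r (u , u∈U) connU =
  let C , C∈Cs , comp , u∈C = component-of enum (U⊆S-r u∈U)
      U⊆C = component-absorbs comp connU U⊆S-r u∈C u∈U
      t , Ct∈ , t∈ts , st , restrict = pointwise-lookupˡ children C∈Cs
      T′ , st′ , paths = restrict U U⊆C (u , u∈U) connU
      trees = Pointwise.map proj₁ children
  in  T′ , st′ , λ v v∈U →
      (λ path′ → let path , w∈U = proj₁ (paths v v∈U) path′ in path-child t∈ts path , w∈U) ,
      (λ (path , w∈U) → proj₂ (paths v v∈U)
        (path-in-child uniq enum trees Ct∈ (U⊆C v∈U) (U⊆C w∈U) path , w∈U))

-- The new children are restrictions of the whole tree, so their path conditions already refer to
-- `node r ts`; only the vertex `r` has to be added to each path.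
restrict-at-root : ∀ {Ds ts′} → Acyclic G → EnumeratesComponents G (S - r) Cs →
  Pointwise (IsSearchTreeOn G) Cs ts → U ⊆ S → ConnectedOn G U → r ∈ U →
  Unique Ds → EnumeratesComponents G (U - r) Ds →
  Pointwise (IsRestrictionOn G (node r ts)) Ds ts′ →
  IsRestrictionOn G (node r ts) U (node r ts′)
restrict-at-root {G = G} {r = r} {ts = ts} {U = U} {Ds = Ds} {ts′ = ts′}
  acyclic enumC children U⊆S connU r∈U uniqD enumD children′ =
  node Ds r∈U uniqD enumD (Pointwise.map proj₁ children′) ,
  λ v v∈U → into , back v∈U
  where
  into : Path (node r ts′) v w → Path (node r ts) v w × w ∈ U
  into (_ , here , here refl) = (_ , here , here refl) , r∈U
  into (_ , there t′∈ p , w∈p) with pointwise-lookupʳ children′ t′∈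
  ... | D , _ , D∈Ds , st′ , paths with w∈p | paths _ (path-⊆ st′ (path-end p))
  ... | here refl | t′⊆T , _ = path-root (proj₁ (t′⊆T (path-end p))) , r∈U
  ... | there w∈p | t′⊆T , _ =
    let path , w∈D = t′⊆T (_ , p , w∈p)
    in  path , p─q⊆p U _ (IsComponent.⊆-S (to (enumD D) D∈Ds) w∈D)

  back : v ∈ U → Path (node r ts) v w × w ∈ U → Path (node r ts′) v w
  back _ ((_ , here , here refl) , _) = _ , here , here refl
  back {v = v} v∈U ((_ , there t∈ p , w∈p) , w∈U) with pointwise-lookupʳ children t∈
  ... | C , _ , C∈Cs , st
    with v∈D ← x∈p∩q⁺ (path-⊆ st (path-end p) , v∈U)
    -- The intersection of `C` with `U` is the component of `U - r` containing `v`, so it is listed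
    -- in `Ds`.
    with compD ← component-of-∩ acyclic U⊆S connU (to (enumC C) C∈Cs) (v , v∈D)
    with t′ , _ , t′∈ , st′ , paths ← pointwise-lookupˡ children′ (from (enumD _) compD)
    with w∈p | paths v v∈D
  -- Here `w` is `r`, which lies on every root path; a path to `v` in `t′` exists because `v` lies
  -- on its own path.
  ... | here refl | _ , T⊆t′ =
    path-root (path-child t′∈ (T⊆t′ (path-child t∈ (path-end p) , v∈D)))
  ... | there w∈p | _ , T⊆t′ =
    let path = _ , p , w∈p
    in  path-child t′∈ (T⊆t′ (path-child t∈ path , x∈p∩q⁺ (path-⊆ st path , w∈U)))

restriction-exists : Acyclic G → IsSearchTreeOn G S T → Restrictable G S T
restriction-exists {G = G} acyclic = searchTree-induction (Restrictable G) step
  where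
  step : r ∈ S → Unique Cs → EnumeratesComponents G (S - r) Cs →
    Pointwise (λ C t → IsSearchTreeOn G C t × Restrictable G C t) Cs ts →
    Restrictable G S (node r ts)
  step {r = r} {Cs = Cs} _ uniq enum children U U⊆S nonempty connU with r ∈? U
  ... | no r∉U = restrict-below-root uniq enum children U
    (λ x∈U → x∈p∧x≢y⇒x∈p-y (U⊆S x∈U) λ { refl → r∉U x∈U }) nonempty connU
  ... | yes r∈U =
    let Ds    = restrictComponents U Cs
        enumD = restrictComponents-enumerates acyclic U⊆S connU enum
        ts′ , children′ = pointwise-choice {xs = Ds} (All.tabulate λ {D} D∈Ds →
          let comp = to (enumD D) D∈Ds
          in  restrict-below-root uniq enum children D
                (⊆-remove U⊆S ∘ IsComponent.⊆-S comp)
                (IsComponent.nonempty comp) (IsComponent.connected comp))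
    in  node r ts′ , restrict-at-root acyclic enum (Pointwise.map proj₁ children) U⊆S connU
          r∈U (restrictComponents-unique U Cs) enumD children′

agree-searchTree : AgreeOn G H S → IsSearchTreeOn G S T → IsSearchTreeOn H S T
agree-searchTree {G = G} {H = H} agree st =
  -- Agreement belongs to the induction predicate because it has to shrink to each component.
  searchTree-induction (λ S T → AgreeOn G H S → IsSearchTreeOn H S T) step st agree
  where
  step : r ∈ S → Unique Cs → EnumeratesComponents G (S - r) Cs →
    Pointwise (λ C t → IsSearchTreeOn G C t × (AgreeOn G H C → IsSearchTreeOn H C t)) Cs ts →
    AgreeOn G H S → IsSearchTreeOn H S (node r ts)
  step {r = r} {S = S} {Cs = Cs} r∈S uniq enum children agree =
    node Cs r∈S uniq
      (λ C → mk⇔ (agree-component agree-r ∘ to (enum C))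
                 (from (enum C) ∘ agree-component (agree-sym {G = G} {H = H} agree-r)))
      (transport children (All.tabulate (λ {C} → IsComponent.⊆-S ∘ to (enum C))))
    where
    agree-r : AgreeOn G H (S - r)
    agree-r = agree-mono {G = G} {H = H} (p─q⊆p S _) agree

    transport : ∀ {Cs ts} →
      Pointwise (λ C t → IsSearchTreeOn G C t × (AgreeOn G H C → IsSearchTreeOn H C t)) Cs ts →
      All (_⊆ S - r) Cs → Pointwise (IsSearchTreeOn H) Cs ts
    transport [] [] = []
    transport ((_ , ih) ∷ children) (C⊆ ∷ Cs⊆) =
      ih (agree-mono {G = G} {H = H} C⊆ agree-r) ∷ transport children Cs⊆

-- Uniqueness

SamePathsOn : Subset n → RootedTree n → RootedTree n → Set
SamePathsOn S T T′ = ∀ v → v ∈ S → Path T v ≐ Path T′ v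

infix 4 _⊑_
-- One half of `_≈_`; the other half comes from exchanging the two trees.
_⊑_ : RootedTree n → RootedTree n → Set
T ⊑ T′ = root T ≡ root T′ × (∀ {u v} → TreeEdge T u v → TreeEdge T′ u v)

Determined : Graph n → Subset n → RootedTree n → Set
Determined G S T = ∀ {T′} → IsSearchTreeOn G S T′ → SamePathsOn S T T′ → T ⊑ T′

paths-determine : IsSearchTreeOn G S T → Determined G S T
paths-determine {G = G} = searchTree-induction (Determined G) step
  where
  step : r ∈ S → Unique Cs → EnumeratesComponents G (S - r) Cs →
    Pointwise (λ C t → IsSearchTreeOn G C t × Determined G C t) Cs ts →
    Determined G S (node r ts)
  step {r = r} {S = S} {Cs = Cs} {ts = ts} r∈S uniq enum children
    (node {r = r′} {ts = ts′} Cs′ _ uniq′ enum′ children′) same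
    -- The root `r′` lies on the path to `r` in the second tree, hence on the path to `r` in the
    -- first, which consists of `r` alone.
    with refl ← path-of-root enum (Pointwise.map proj₁ children)
      (proj₂ (same r r∈S) (path-root (proj₁ (same r r∈S) (_ , here , here refl))))
    = refl , edges
    where
    trees : Pointwise (IsSearchTreeOn G) Cs ts
    trees = Pointwise.map proj₁ children

    -- With equal roots, both trees branch over the same components, so children are paired by their
    -- component.
    match : t List.∈ ts → ∃[ t′ ] t′ List.∈ ts′ × t ⊑ t′
    match t∈ with pointwise-lookupʳ children t∈
    ... | C , Ct∈ , C∈Cs , st , determined
      with comp ← to (enum C) C∈Cs
      with t′ , Ct′∈ , t′∈ , st′ ← pointwise-lookupˡ children′ (from (enum′ C) comp)
      = t′ , t′∈ , determined st′ λ v v∈C →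
        let v∈S = p─q⊆p S _ (IsComponent.⊆-S comp v∈C) in
        (λ path → path-in-child uniq′ enum′ children′ Ct′∈ v∈C (path-⊆ st path)
          (proj₁ (same v v∈S) (path-child t∈ path))) ,
        (λ path → path-in-child uniq enum trees Ct∈ v∈C (path-⊆ st′ path)
          (proj₂ (same v v∈S) (path-child t′∈ path)))

    edges : TreeEdge (node r ts) u v → TreeEdge (node r ts′) u v
    edges (top t∈) =
      let t′ , t′∈ , root≡ , _ = match t∈
      in  subst (TreeEdge (node r ts′) r) (sym root≡) (top t′∈)
    edges (below t∈ e) =
      let t′ , t′∈ , _ , edges⊆ = match t∈
      in  below t′∈ (edges⊆ e)

mainTheorem13 : (n : ℕ) (𝒯 : Graph n) → IsTree 𝒯 →
    (T : RootedTree n) → IsSearchTree 𝒯 T →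
    (ℋ : Graph n) → Subgraph ℋ 𝒯 → Nonempty (V ℋ) → Connected ℋ →
    ∃! _≈_ (λ T∣ℋ → IsSearchTree ℋ T∣ℋ ×
    (∀ v → v ∈ V ℋ → Path T∣ℋ v ≐ Path T v ∩ (_∈ V ℋ)))
mainTheorem13 n 𝒯 tree T st ℋ ℋ⊆𝒯 nonempty connected =
  let acyclic = IsTree.acyclic tree
      agree   = connected-subgraph-induced acyclic ℋ⊆𝒯 connected
      -- The restriction is built in `𝒯`, where acyclicity and `T` are available, and then carried
      -- over to `ℋ` by agreement.
      T₁ , st₁ , paths₁ = restriction-exists acyclic st (V ℋ) (Subgraph.V-⊆ ℋ⊆𝒯) nonempty
        (agree-connected {G = ℋ} {H = 𝒯} (agree-sym {G = 𝒯} {H = ℋ} agree) id connected)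
      st₁ℋ = agree-searchTree agree st₁
  in  T₁ , (st₁ℋ , paths₁) , λ (st₂ , paths₂) →
      let same  = λ v v∈ → ≐-trans (paths₁ v v∈) (≐-sym (paths₂ v v∈))
          same′ = λ v v∈ → ≐-sym (same v v∈)
          root≡ , edges₁₂ = paths-determine st₁ℋ st₂ same
          _     , edges₂₁ = paths-determine st₂ st₁ℋ same′
      in  root≡ , λ u v → mk⇔ edges₁₂ edges₂₁
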